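{- Let $\mathcal L$ be a FOLDS signature of height $3$ and let $\mathbb T$ be an $\mathcal L$-theory. For any saturated (i.e. totally saturated) $\mathbb T$-models $\mathcal M$ and $\mathcal N$ there is an equivalence of types $$(\mathcal M \simeq_{\mathcal L} \mathcal N)\;\simeq\;(\mathcal M =_{\mathbf{SatMod}_{\mathbb T}} \mathcal N),$$ where $\mathbf{SatMod}_{\mathbb T}$ is the type of totally saturated $\mathbb T$-models and $\simeq_{\mathcal L}$ is type-theoretic FOLDS equivalence on $\mathbf{SatMod}_{\mathbb T}$.
   Context: FOLDS syntax. A FOLDS signature $\mathcal L$ is a finite inverse category; its objects are called sorts and $\mathcal L(K,K')$ denotes its hom-sets. The level of a sort is $l(K)=1$ if $K$ is the codomain only of $1_K$, and otherwise $l(K)=\sup_{f\colon K_f\to K,\ f\neq 1_K} l(K_f)+1$. Write $R>K$ if $l(R)<l(K)$. The height of $\mathcal L$ is the maximal level of its sorts. Variables are given by a functor $V\colon\mathcal L\to\mathbf{Set}$ with the $V(K)$ countably infinite and pairwise disjoint (and enough variables over every boundary). Write $x\colon K$ for $x\in V(K)$, and $x_f$ for $V(f)(x)$ when $f\in\mathcal L(K,K_f)$. Put $\mathrm{dep}(x)=\{x_f\mid \mathrm{dom}(f)=K\}$ and $\partial x=\mathrm{dep}(x)\setminus\{x\}$ (the boundary of $x$). A context is a finite subfunctor of $V$; a context morphism is a natural transformation. Formulas are built from $\top,\bot,\wedge,\vee,\rightarrow$ and quantifiers $\forall x\colon K$, $\exists x\colon K$ (a variable may be bound only if no other free variable depends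 on it; $\partial x$ remains free), and are taken up to $\alpha$-equivalence. A theory is a set of sentences (closed formulas). "$\forall x\colon K(\alpha)$" (and "$\exists x\colon K(\alpha)$") quantifies over a variable $x\colon K$ with $\partial x=\partial\alpha$. For $l(R)=1$, $R(\alpha)$ abbreviates $\exists\alpha\colon R.\top$. Formulas $\phi$ in context $\Gamma$ and $\psi$ in context $\Delta$ are contextually equivalent, $\phi\sim_c\psi$, if some isomorphism of contexts $s\colon\Gamma\to\Delta$ satisfies $s(\phi)\equiv_\alpha\psi$. For a set of variables $\Gamma$, $\forall\Gamma\,\phi$ is universal closure over $\Gamma$. Indistinguishability and equivalence (syntactic). For $x\colon K$ let $\mathcal L_x$ be the set of sorts $R>K$ such that for all $q\in\mathcal L(R,K)$ and all $p_1,p_2\in\mathcal L(K,K')$, $p_1q=p_2q$ implies $x_{p_1}=x_{p_2}$. By mutual induction on level, for $x,y\colon K$ and $\alpha,\beta\colon K$: $\mathrm{Ind}(x,y)=\bigwedge_{R\in\mathcal L_x\cap\mathcal L_y}\bigwedge_{p\in\mathcal L(R,K)}\mathrm{Ind}_R^p(x,y)$, where $\mathrm{Ind}_R^p(x,y)$ is the conjunction, taking one representative up to $\sim_c$, of all formulas $\forall\Gamma_{\alpha,\beta}\,R(\alpha)\simeq R(\beta)$ with $\alpha,\beta\colon R$, $\alpha_p=x$, $\beta_p=y$, $\alpha_q=\beta_q$ for all $q\in\mathcal L(R,K)$ with $q\ne p$, and $\Gamma_{\alpha,\beta}=(\partial\alpha\cup\partial\beta)\setminus(\mathrm{dep}(\alpha_p)\cup\mathrm{dep}(\beta_p))$;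 when $\partial x=\partial y$ write $x\cong y$ for $\mathrm{Ind}(x,y)$; and $K(\alpha)\simeq K(\beta)$ is $[\forall x\colon K(\alpha)\,\exists y\colon K(\beta).\,\mathrm{Ind}(x,y)\wedge(\forall y'\colon K(\beta).\,\mathrm{Ind}(x,y')\to y\cong y')]\wedge[\forall x,x'\colon K(\alpha)\,\forall y,y'\colon K(\beta).\,\mathrm{Ind}(x,y)\wedge\mathrm{Ind}(x',y')\wedge y\cong y'\to x\cong x']\wedge[\forall y\colon K(\beta)\,\exists x\colon K(\alpha).\,\mathrm{Ind}(x,y)]$. Type theory. We work in Homotopy Type Theory with a univalent universe $\mathcal U$. The $h$-level of propositions is $1$, of sets $2$, of $1$-types $3$. The type $\mathbf{Str}_{\mathcal L}$ of $\mathcal L$-structures is the $\Sigma$-type extracted from $\mathcal L$ by induction on level, in which each sort is a $\mathcal U$-valued type family over its boundary; $K^{\mathcal M}$ is the interpretation of $K$ in $\mathcal M$, and $\Gamma^{\mathcal M}$ the interpretation of a context $\Gamma$. Formulas are interpreted by propositions-as-types with $\exists$ and $\vee$ propositionally truncated; a $\mathbb T$-model is an $\mathcal L$-structure satisfying all sentences of $\mathbb T$. However, $\mathrm{Ind}$, $\cong$ and $\simeq$ are interpreted in $\mathcal M$ with untruncated existentials: $\mathrm{Ind}^{\mathcal M}(x,y)$ is the finite product over $R\in\mathcal L_x\cap\mathcal L_y$, $p\in\mathcal L(R,K)$ and the pairs $(\alpha,\beta)$ (up to $\sim_c$ of the formulas $\forall\Gamma_{\alpha,\beta}\,R(\alpha)\simeq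 R(\beta)$) with $\alpha,\beta\colon R$, $\alpha_p=x$, $\beta_p=y$ and $\alpha_q=\beta_q$ for all $q\in\mathcal L(R,K)$ with $q\ne p$, of $\prod_{\mathbf z\colon\Gamma^{\mathcal M}_{\alpha,\beta}}R(\alpha)\simeq^{\mathcal M}R(\beta)$, where $\Gamma_{\alpha,\beta}=(\partial\alpha\cup\partial\beta)\setminus(\mathrm{dep}(\alpha_p)\cup\mathrm{dep}(\beta_p))$; $x\cong^{\mathcal M}y$ is $\mathrm{Ind}^{\mathcal M}(x,y)$ when $\partial x=\partial y$; and $K(\alpha)\simeq^{\mathcal M}K(\beta)$ is $\big[\prod_{x\colon K^{\mathcal M}(\alpha)}\sum_{y\colon K^{\mathcal M}(\beta)}\mathrm{Ind}^{\mathcal M}(x,y)\times\prod_{y'\colon K^{\mathcal M}(\beta)}(\mathrm{Ind}^{\mathcal M}(x,y')\to y\cong^{\mathcal M}y')\big]\times\big[\prod_{x,x'\colon K^{\mathcal M}(\alpha)}\prod_{y,y'\colon K^{\mathcal M}(\beta)}(\mathrm{Ind}^{\mathcal M}(x,y)\times\mathrm{Ind}^{\mathcal M}(x',y')\times y\cong^{\mathcal M}y'\to x\cong^{\mathcal M}x')\big]\times\big[\prod_{y\colon K^{\mathcal M}(\beta)}\sum_{x\colon K^{\mathcal M}(\alpha)}\mathrm{Ind}^{\mathcal M}(x,y)\big]$. The relation $\cong^{\mathcal M}$ is reflexive, giving by identity induction a map $\mathtt{idtoiso}_{x,y}\colon (x=y)\to(x\cong^{\mathcal M}y)$. In a context $\Gamma^{\mathcal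 M}$ with $\Gamma$ appropriate to $K$, saturation for $K^{\mathcal M}$ is the proposition $\prod_{x,y\colon K^{\mathcal M}}\mathtt{isequiv}(\mathtt{idtoiso}_{x,y})$. $\mathcal M$ is $K$-saturated if this is inhabited, $n$-saturated (saturated at level $n$) if it is $K$-saturated for all sorts with $l(K)\le n$, and totally saturated if saturated at every level. $\mathbf{SatMod}_{\mathbb T}$ is the type of totally saturated $\mathbb T$-models. FOLDS equivalence. For $\mathcal L$ of height $3$, let $\mathbf O$, $\mathbf A$, $\mathbf R$ denote the families of sorts of levels $3,2,1$ (boldface expressions mean the product over the whole family). The type of $\mathcal L$-homomorphisms is $\mathrm{Hom}_{\mathcal L}(\mathcal M,\mathcal N)=\sum_{m_{\mathbf O}\colon\mathbf O^{\mathcal M}\to\mathbf O^{\mathcal N}}\ \sum_{m_{\mathbf A}\colon\prod_{\mathbf x\colon\mathbf O^{\mathcal M}}\mathbf A^{\mathcal M}(\mathbf x)\to\mathbf A^{\mathcal N}(m_{\mathbf O}(\mathbf x))}\ \prod_{\mathbf x\colon\mathbf O^{\mathcal M},\,\mathbf y\colon\mathbf A^{\mathcal M}(\mathbf x)}\mathbf R^{\mathcal M}(\mathbf x,\mathbf y)\to\mathbf R^{\mathcal N}(m_{\mathbf O}(\mathbf x),m_{\mathbf A}(\mathbf x)(\mathbf y))$. For $f\colon A\to B$ put $\mathtt{sps}(f)=\prod_{y\colon B}\sum_{x\colon A}f(x)=y$ (type of splittings, not a proposition). For $m\colon\mathrm{Hom}_{\mathcal L}(\mathcal M,\mathcal N)$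 put $\mathtt{fibsurj}(m)=\mathtt{sps}(m_{\mathbf O})\times\prod_{\mathbf x\colon\mathbf O^{\mathcal M}}\mathtt{sps}(m_{\mathbf A}(\mathbf x))\times\prod_{\mathbf x\colon\mathbf O^{\mathcal M},\mathbf y\colon\mathbf A^{\mathcal M}(\mathbf x)}\mathtt{sps}(m_{\mathbf R}(\mathbf x,\mathbf y))$, and $\mathbf{FibSurj}(\mathcal M,\mathcal N)=\sum_{m\colon\mathrm{Hom}_{\mathcal L}(\mathcal M,\mathcal N)}\mathtt{fibsurj}(m)$. For $\mathcal M,\mathcal N\colon\mathbf{SatMod}_{\mathbb T}$, $$\mathcal M\simeq_{\mathcal L}\mathcal N=\sum_{\mathcal P\colon\mathbf{SatMod}_{\mathbb T}}\mathbf{FibSurj}(\mathcal P,\mathcal M)\times\mathbf{FibSurj}(\mathcal P,\mathcal N).$$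
   Formalization: Saturation is taken to include reflexivity of the indistinguishability relation, which the text asserts but which fails in some structures for the stated definition of Ind; without it the map idtoiso, and hence saturation, is undefined. -}

{-# OPTIONS --safe --without-K #-}
module Defs where

open import Level using (Level; Setω; _⊔_; 0ℓ) renaming (suc to lsuc)
open import Axiom.Extensionality.Propositional using (Extensionality)
open import Data.Empty.Polymorphic using (⊥)
open import Data.Fin using (Fin; zero; suc; _≟_)
open import Data.List using (List; []; _∷_; [_]; _++_; map; concatMap; allFin; foldr; filter; deduplicate)
open import Axiom.UniquenessOfIdentityProofs using (module Decidable⇒UIP)
open import Data.List.Membership.DecPropositional using (_∉?_)
open import Data.Nat using (ℕ; zero; suc) renaming (_⊔_ to _⊔ℕ_; _≟_ to _≟ℕ_)
open import Data.Product using (Σ; Σ-syntax; _×_; _,_)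
open import Data.Sum using (_⊎_)
open import Data.Unit.Polymorphic using (⊤; tt)
open import Induction.WellFounded using (WellFounded; module All)
open import Relation.Binary.PropositionalEquality using (_≡_; _≢_; refl; subst)
open import Relation.Nullary using (¬_; Dec; yes; no)
open import Relation.Unary using (Pred)

isProp : ∀ {a} → Set a → Set a
isProp A = (x y : A) → x ≡ y

isContr : ∀ {a} → Set a → Set a
isContr A = Σ[ c ∈ A ] ((x : A) → c ≡ x)

fiber : ∀ {a b} {A : Set a} {B : Set b} → (A → B) → B → Set (a ⊔ b)
fiber {A = A} f y = Σ[ x ∈ A ] f x ≡ y

isEquiv : ∀ {a b} {A : Set a} {B : Set b} → (A → B) → Set (a ⊔ b)
isEquiv {B = B} f = (y : B) → isContr (fiber f y)

infix 4 _≃_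

_≃_ : ∀ {a b} → Set a → Set b → Set (a ⊔ b)
A ≃ B = Σ[ f ∈ (A → B) ] isEquiv f

idtoeqv : ∀ {a} {A B : Set a} → A ≡ B → A ≃ B
idtoeqv refl = (λ x → x) , λ y → (y , refl) , λ { (_ , refl) → refl }

-- What the ambient theory adds to intensional type theory (without K): the
-- universe Set ℓ is univalent, functions are extensional, and propositional
-- truncations exist.
record HoTT (ℓ : Level) : Setω where
  field
    univalence : (A B : Set ℓ) → isEquiv (idtoeqv {A = A} {B})
    funext     : ∀ {a b} → Extensionality a b
    ∥_∥        : Set ℓ → Set ℓ
    ∣_∣        : {A : Set ℓ} → A → ∥ A ∥
    squash     : {A : Set ℓ} → isProp ∥ A ∥
    ∥∥-rec     : ∀ {p} {A : Set ℓ} {P : Set p} → isProp P → (A → P) → ∥ A ∥ → P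

record FiniteCategory : Set where
  infixr 9 _∘_
  field
    #sorts : ℕ
    #hom   : Fin #sorts → Fin #sorts → ℕ

  Sort : Set
  Sort = Fin #sorts

  Hom : Sort → Sort → Set
  Hom K K′ = Fin (#hom K K′)

  field
    id        : ∀ {K} → Hom K K
    _∘_       : ∀ {K K′ K″} → Hom K′ K″ → Hom K K′ → Hom K K″
    identityˡ : ∀ {K K′} (f : Hom K K′) → id ∘ f ≡ f
    identityʳ : ∀ {K K′} (f : Hom K K′) → f ∘ id ≡ f
    assoc     : ∀ {K K′ K″ K‴} (h : Hom K″ K‴) (g : Hom K′ K″) (f : Hom K K′) →
                (h ∘ g) ∘ f ≡ h ∘ (g ∘ f)

  IsId : ∀ {K K′} → Hom K K′ → Set
  IsId {K} {K′} f = Σ[ e ∈ K ≡ K′ ] subst (Hom K) e id ≡ f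

  isId? : ∀ {K K′} (f : Hom K K′) → Dec (IsId f)
  isId? {K} {K′} f with K ≟ K′
  ... | no K≢K′ = no λ (e , _) → K≢K′ e
  ... | yes refl with id ≟ f
  ...   | yes e    = yes (refl , e)
  ...   | no id≢f  = no λ (e , p) →
          id≢f (subst (λ e → subst (Hom K) e id ≡ f) (Decidable⇒UIP.≡-irrelevant _≟_ e refl) p)

  -- There is a non-identity arrow K′ → K.
  _▸_ : Sort → Sort → Set
  K′ ▸ K = Σ[ f ∈ Hom K′ K ] ¬ IsId f

record FOLDSSignature : Set where
  field
    category : FiniteCategory
  open FiniteCategory category public
  field
    -- As there are finitely many sorts, excluding infinite chains of
    -- non-identity arrows … → K₁ → K₀ excludes those K₀ → K₁ → … as well.
    inverse : WellFounded _▸_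

  -- The supremum of the empty set is 0, so a sort that is the codomain of its
  -- identity only gets level 1.
  level : Sort → ℕ
  level = wfRec (λ _ → ℕ) λ K rec →
    suc (foldr _⊔ℕ_ 0 (concatMap (λ K′ → map (λ f → contribution rec f (isId? f)) (allFin (#hom K′ K)))
                                 (allFin #sorts)))
    where
    open All inverse 0ℓ using (wfRec)
    contribution : ∀ {K K′} → (∀ {K′} → K′ ▸ K → ℕ) → (f : Hom K′ K) → Dec (IsId f) → ℕ
    contribution rec f (yes _)    = 0
    contribution rec f (no ¬f-id) = rec (f , ¬f-id)

  height : ℕ
  height = foldr _⊔ℕ_ 0 (map level (allFin #sorts))

  record SortAt (n : ℕ) : Set where
    constructor at-level
    field
      sort    : Sort
      level≡n : level sort ≡ n
  open SortAt public

  infix 4 _⇒_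
  _⇒_ : ∀ {m n} → SortAt m → SortAt n → Set
  K ⇒ K′ = Hom (sort K) (sort K′)

  arrows : ∀ {m} (K : SortAt m) (n : ℕ) → List (Σ[ K′ ∈ SortAt n ] K ⇒ K′)
  arrows K n = concatMap into (allFin #sorts)
    where
    into : Sort → List (Σ[ K′ ∈ SortAt n ] K ⇒ K′)
    into K′ with level K′ ≟ℕ n
    ... | yes e = map (at-level K′ e ,_) (allFin (#hom (sort K) K′))
    ... | no _  = []

-- The syntax is for signatures of height 3: arrows out of a sort of level 2 are its
-- identity and arrows into level 3; arrows out of a sort of level 1 are its
-- identity and arrows into levels 3 and 2.

module FOLDS (𝓛 : FOLDSSignature) where

  open FOLDSSignature 𝓛

  𝐎 𝐀 𝐑 : Set
  𝐎 = SortAt 3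
  𝐀 = SortAt 2
  𝐑 = SortAt 1

  -- A context (a finite functor 𝓛 → Set) is given as a telescope of variable
  -- declarations, each over a boundary in the preceding variables.  VarO Γ K,
  -- VarA Γ K b, VarR Γ S b are the variables of a sort in Γ, for levels 2 and 1
  -- those with boundary b; so x_f is read off from the boundary of x, and the
  -- functor laws x_{fg} = (x_g)_f are built into BdryR.
  infixl 5 _▹_

  data Ctx : Set
  data Decl (Γ : Ctx) : Set
  data VarO : Ctx → 𝐎 → Set

  record BdryA (Γ : Ctx) (K : 𝐀) : Set
  data VarA : (Γ : Ctx) (K : 𝐀) → BdryA Γ K → Set
  record BdryR (Γ : Ctx) (S : 𝐑) : Set

  data Ctx where
    ∅   : Ctx
    _▹_ : (Γ : Ctx) → Decl Γ → Ctx

  data Decl Γ where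
    decO : 𝐎 → Decl Γ
    decA : (K : 𝐀) → BdryA Γ K → Decl Γ
    decR : (S : 𝐑) → BdryR Γ S → Decl Γ

  data VarO where
    here  : ∀ {Γ K} → VarO (Γ ▹ decO K) K
    there : ∀ {Γ D K} → VarO Γ K → VarO (Γ ▹ D) K

  record BdryA Γ K where
    inductive
    eta-equality
    constructor bdryA
    field
      var : (X : 𝐎) → K ⇒ X → VarO Γ X
  open BdryA public

  wkA : ∀ {Γ D K} → BdryA Γ K → BdryA (Γ ▹ D) K
  wkA b = bdryA (λ X f → there (var b X f))

  data VarA where
    here  : ∀ {Γ K b} → VarA (Γ ▹ decA K b) K (wkA b)
    there : ∀ {Γ D K b} → VarA Γ K b → VarA (Γ ▹ D) K (wkA b)

  record BdryR Γ S where
    inductive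
    eta-equality
    constructor bdryR
    field
      onO : (X : 𝐎) → S ⇒ X → VarO Γ X
      onA : (K : 𝐀) (g : S ⇒ K) → VarA Γ K (bdryA (λ X f → onO X (f ∘ g)))
  open BdryR public

  infixr 6 _∧′_
  infixr 5 _∨′_
  infixr 4 _⇒′_

  -- Formulas are well scoped: α-equivalent formulas are identical, and a
  -- quantifier binds the last variable, on which no other one depends.
  data Formula (Γ : Ctx) : Set where
    ⊤′ ⊥′          : Formula Γ
    _∧′_ _∨′_ _⇒′_ : Formula Γ → Formula Γ → Formula Γ
    ∀′ ∃′          : (D : Decl Γ) → Formula (Γ ▹ D) → Formula Γ

  Sentence : Set
  Sentence = Formula ∅

  Theory : (t : Level) → Set (lsuc t)
  Theory t = Pred Sentence t

  -- De Bruijn indices forget sorts and boundaries, so that variables over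
  -- different boundaries can be compared.
  length : Ctx → ℕ
  length ∅       = 0
  length (Γ ▹ _) = suc (length Γ)

  Var : Ctx → Set
  Var Γ = Fin (length Γ)

  varO : ∀ {Γ K} → VarO Γ K → Var Γ
  varO here      = zero
  varO (there x) = suc (varO x)

  varA : ∀ {Γ K b} → VarA Γ K b → Var Γ
  varA here      = zero
  varA (there x) = suc (varA x)

  -- Γ ⊑ Θ: Θ declares further variables after those of Γ.
  infix 4 _⊑_
  data _⊑_ (Γ : Ctx) : Ctx → Set where
    done : Γ ⊑ Γ
    more : ∀ {Θ} → Γ ⊑ Θ → (D : Decl Θ) → Γ ⊑ Θ ▹ D

  old : ∀ {Γ Θ} → Γ ⊑ Θ → Var Γ → Var Θ
  old done       x = x
  old (more e D) x = suc (old e x)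

  new : ∀ {Γ Θ} → Γ ⊑ Θ → List (Var Θ)
  new done       = []
  new (more e D) = map suc (new e) ++ [ zero ]

  -- The sorts below level 3, and their boundaries.
  data Lower : Set where
    lowA : 𝐀 → Lower
    lowR : 𝐑 → Lower

  _⇒ᴼ_ : Lower → 𝐎 → Set
  lowA S ⇒ᴼ X = S ⇒ X
  lowR S ⇒ᴼ X = S ⇒ X

  Bdry : Ctx → Lower → Set
  Bdry Γ (lowA S) = BdryA Γ S
  Bdry Γ (lowR S) = BdryR Γ S

  atO : ∀ {Γ} S X → Bdry Γ S → S ⇒ᴼ X → Var Γ
  atO (lowA S) X b f = varO (var b X f)
  atO (lowR S) X b f = varO (onO b X f)

  atA : ∀ {Γ} (S : 𝐑) (K : 𝐀) → BdryR Γ S → S ⇒ K → Var Γ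
  atA S K b g = varA (onA b K g)

  ∂O ∂A ∂ : ∀ {Γ} S → Bdry Γ S → List (Var Γ)
  ∂O (lowA S) b = map (λ (X , f) → atO (lowA S) X b f) (arrows S 3)
  ∂O (lowR S) b = map (λ (X , f) → atO (lowR S) X b f) (arrows S 3)
  ∂A (lowA S) b = []
  ∂A (lowR S) b = map (λ (K , g) → atA S K b g) (arrows S 2)
  ∂ S b = ∂O S b ++ ∂A S b

  -- The pairs α, β : S indexing Ind_S^p(x, y), where Arr = 𝓛(S, K) for the sort
  -- K of x and y, b ↦ at b is b ↦ (q ↦ b_q), and depxy lists dep(x) ∪ dep(y).
  -- Only the boundaries of α and β matter.  They live in an extension Θ of Γ by
  -- Γ_{α,β} = (∂α ∪ ∂β) ∖ (dep(x) ∪ dep(y)); requiring Θ to declare these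
  -- variables in the order of their first occurrence (level 3 before level 2)
  -- selects exactly one pair from each class up to contextual equivalence:
  -- equivalent pairs differ by a renaming, which must fix x = α_p and y = β_p.
  record Pair {Γ : Ctx} (S : Lower) (Arr : Set) (at : ∀ {Θ} → Bdry Θ S → Arr → Var Θ)
              (p : Arr) (x y : Var Γ) (depxy : List (Var Γ)) : Set where
    field
      {Θ}   : Ctx
      ext   : Γ ⊑ Θ
      α β   : Bdry Θ S
      α-p   : at α p ≡ old ext x
      β-p   : at β p ≡ old ext y
      agree : ∀ q → q ≢ p → at α q ≡ at β q

    ∂α∪∂β : List (Var Θ)
    ∂α∪∂β = (∂O S α ++ ∂O S β) ++ (∂A S α ++ ∂A S β)

    Γαβ : List (Var Θ)
    Γαβ = deduplicate _≟_ (filter (λ v → _∉?_ _≟_ v (map (old ext) depxy)) ∂α∪∂β)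

    field
      new-vars : new ext ≡ Γαβ

  CtxO : 𝐎 → Ctx
  CtxO K = ∅ ▹ decO K ▹ decO K

  PairO : (K : 𝐎) (S : Lower) → S ⇒ᴼ K → Set
  PairO K S p = Pair {CtxO K} S (S ⇒ᴼ K) (atO S K) p x y (x ∷ y ∷ [])
    where
    x y : Var (CtxO K)
    x = suc zero
    y = zero

  CtxA : (Γ : Ctx) (K : 𝐀) (α β : BdryA Γ K) → Ctx
  CtxA Γ K α β = Γ ▹ decA K α ▹ decA K (wkA β)

  PairA : (Γ : Ctx) (K : 𝐀) (α β : BdryA Γ K) (S : 𝐑) → S ⇒ K → Set
  PairA Γ K α β S p =
    Pair {CtxA Γ K α β} (lowR S) (S ⇒ K) (atA S K) p x y
         ((x ∷ ∂ (lowA K) (weaken α)) ++ (y ∷ ∂ (lowA K) (weaken β)))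
    where
    weaken : BdryA Γ K → BdryA (CtxA Γ K α β) K
    weaken b = wkA (wkA b)
    x y : Var (CtxA Γ K α β)
    x = suc zero
    y = zero

  -- S ∈ 𝓛_x for x : K with boundary b.  (Two arrows from K to itself are equal,
  -- so only arrows into level 3 impose a condition; likewise, if K has level 3
  -- then 𝓛_x consists of all sorts of level < 3.)
  In𝓛 : ∀ {Γ} (K : 𝐀) → BdryA Γ K → 𝐑 → Set
  In𝓛 K b S = ∀ (q : S ⇒ K) {X : 𝐎} (p₁ p₂ : K ⇒ X) → p₁ ∘ q ≡ p₂ ∘ q → var b X p₁ ≡ var b X p₂

  record Str (ℓ : Level) : Set (lsuc ℓ) where
    field
      O^ : 𝐎 → Set ℓ
      A^ : (K : 𝐀) → ((X : 𝐎) → K ⇒ X → O^ X) → Set ℓ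
      R^ : (S : 𝐑) (o : (X : 𝐎) → S ⇒ X → O^ X) →
           ((K : 𝐀) (g : S ⇒ K) → A^ K (λ X f → o X (f ∘ g))) → Set ℓ

  module _ {ℓ : Level} (𝓜 : Str ℓ) where
    open Str 𝓜

    ⟦_⟧  : Ctx → Set ℓ
    ⟦_⟧ᴰ : ∀ {Γ} → Decl Γ → ⟦ Γ ⟧ → Set ℓ
    ⟦_⟧ᴼ : ∀ {Γ K} → VarO Γ K → ⟦ Γ ⟧ → O^ K

    ⟦ ∅ ⟧     = ⊤
    ⟦ Γ ▹ D ⟧ = Σ[ γ ∈ ⟦ Γ ⟧ ] ⟦ D ⟧ᴰ γ

    -- K^𝓜(α) at an element of the context of α.
    A⟨_⟩ : ∀ {Γ} {K : 𝐀} → BdryA Γ K → ⟦ Γ ⟧ → Set ℓ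
    A⟨_⟩ {K = K} b γ = A^ K (λ X f → ⟦ var b X f ⟧ᴼ γ)

    ⟦_⟧ᴬ : ∀ {Γ K} {b : BdryA Γ K} → VarA Γ K b → (γ : ⟦ Γ ⟧) → A⟨ b ⟩ γ

    R⟨_⟩ : ∀ {Γ} {S : 𝐑} → BdryR Γ S → ⟦ Γ ⟧ → Set ℓ
    R⟨_⟩ {S = S} b γ = R^ S (λ X f → ⟦ onO b X f ⟧ᴼ γ) (λ K g → ⟦ onA b K g ⟧ᴬ γ)

    ⟦ decO K ⟧ᴰ   γ = O^ K
    ⟦ decA K b ⟧ᴰ γ = A⟨ b ⟩ γ
    ⟦ decR S b ⟧ᴰ γ = R⟨ b ⟩ γ

    ⟦ here ⟧ᴼ    (γ , d) = d
    ⟦ there x ⟧ᴼ (γ , d) = ⟦ x ⟧ᴼ γ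

    ⟦ here ⟧ᴬ    (γ , d) = d
    ⟦ there x ⟧ᴬ (γ , d) = ⟦ x ⟧ᴬ γ

    module _ (𝓗 : HoTT ℓ) where
      open HoTT 𝓗 using (∥_∥)

      _⊨_ : ∀ {Γ} → ⟦ Γ ⟧ → Formula Γ → Set ℓ
      γ ⊨ ⊤′       = ⊤
      γ ⊨ ⊥′       = ⊥
      γ ⊨ (φ ∧′ ψ) = (γ ⊨ φ) × (γ ⊨ ψ)
      γ ⊨ (φ ∨′ ψ) = ∥ (γ ⊨ φ) ⊎ (γ ⊨ ψ) ∥
      γ ⊨ (φ ⇒′ ψ) = γ ⊨ φ → γ ⊨ ψ
      γ ⊨ (∀′ D φ) = (d : ⟦ D ⟧ᴰ γ) → (γ , d) ⊨ φ
      γ ⊨ (∃′ D φ) = ∥ Σ[ d ∈ ⟦ D ⟧ᴰ γ ] (γ , d) ⊨ φ ∥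

      IsModel : ∀ {t} → Theory t → Set (ℓ ⊔ t)
      IsModel 𝕋 = (φ : Sentence) → 𝕋 φ → tt ⊨ φ

    Π⟨_⟩ : ∀ {Γ Θ} → Γ ⊑ Θ → ⟦ Γ ⟧ → (⟦ Θ ⟧ → Set ℓ) → Set ℓ
    Π⟨ done ⟩     γ P = P γ
    Π⟨ more e D ⟩ γ P = Π⟨ e ⟩ γ (λ θ → (d : ⟦ D ⟧ᴰ θ) → P (θ , d))

    -- K(α) ≃ K(β) for X = K^𝓜(α) and Y = K^𝓜(β).
    Bij : (X Y : Set ℓ) (Ind : X → Y → Set ℓ) (_≅X_ : X → X → Set ℓ) (_≅Y_ : Y → Y → Set ℓ) → Set ℓ
    Bij X Y Ind _≅X_ _≅Y_ =
        ((x : X) → Σ[ y ∈ Y ] (Ind x y × ((y′ : Y) → Ind x y′ → y ≅Y y′)))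
      × ((x x′ : X) (y y′ : Y) → Ind x y × Ind x′ y′ × y ≅Y y′ → x ≅X x′)
      × ((y : Y) → Σ[ x ∈ X ] Ind x y)

    -- No sort has level < 1, so this is an empty product.
    IndR : ∀ {Γ} {S : 𝐑} (γ : ⟦ Γ ⟧) (α β : BdryR Γ S) → R⟨ α ⟩ γ → R⟨ β ⟩ γ → Set ℓ
    IndR γ α β x y = ⊤

    BijR : ∀ {Γ} {S : 𝐑} (γ : ⟦ Γ ⟧) (α β : BdryR Γ S) → Set ℓ
    BijR γ α β = Bij (R⟨ α ⟩ γ) (R⟨ β ⟩ γ) (IndR γ α β) (IndR γ α α) (IndR γ β β)

    IndA : ∀ {Γ} {K : 𝐀} (γ : ⟦ Γ ⟧) (α β : BdryA Γ K) → A⟨ α ⟩ γ → A⟨ β ⟩ γ → Set ℓ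
    IndA {Γ} {K} γ α β x y =
      (S : 𝐑) → In𝓛 K α S → In𝓛 K β S → (p : S ⇒ K) (π : PairA Γ K α β S p) →
      let open Pair π renaming (α to α′; β to β′) in
      Π⟨ ext ⟩ ((γ , x) , y) (λ θ → BijR θ α′ β′)

    BijA : ∀ {Γ} {K : 𝐀} (γ : ⟦ Γ ⟧) (α β : BdryA Γ K) → Set ℓ
    BijA γ α β = Bij (A⟨ α ⟩ γ) (A⟨ β ⟩ γ) (IndA γ α β) (IndA γ α α) (IndA γ β β)

    BijLower : ∀ {Γ} (S : Lower) (γ : ⟦ Γ ⟧) (α β : Bdry Γ S) → Set ℓ
    BijLower (lowA S) = BijA
    BijLower (lowR S) = BijR

    IndO : (K : 𝐎) → O^ K → O^ K → Set ℓ
    IndO K x y =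
      (S : Lower) (p : S ⇒ᴼ K) (π : PairO K S p) →
      let open Pair π in
      Π⟨ ext ⟩ ((tt , x) , y) (λ θ → BijLower S θ α β)

    -- The reflexivity of ≅ that idtoiso is built from is part of
    -- the data, since it does not hold in every structure: in a conjunct S(α) ≃ S(β)
    -- of Ind, α_r and β_r may be distinct variables for arrows r out of S that do
    -- not end in K.

    idtoiso : {X : Set ℓ} {_≅_ : X → X → Set ℓ} → (∀ x → x ≅ x) → (x y : X) → x ≡ y → x ≅ y
    idtoiso r x .x refl = r x

    Saturation : (X : Set ℓ) (_≅_ : X → X → Set ℓ) → Set ℓ
    Saturation X _≅_ = Σ[ r ∈ (∀ x → x ≅ x) ] ((x y : X) → isEquiv (idtoiso {_≅_ = _≅_} r x y))

    Saturatedᴼ : 𝐎 → Set ℓ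
    Saturatedᴼ K = Saturation (O^ K) (IndO K)

    Saturatedᴬ : 𝐀 → Set ℓ
    Saturatedᴬ K = (Γ : Ctx) (b : BdryA Γ K) (γ : ⟦ Γ ⟧) → Saturation (A⟨ b ⟩ γ) (IndA γ b b)

    Saturatedᴿ : 𝐑 → Set ℓ
    Saturatedᴿ S = (Γ : Ctx) (b : BdryR Γ S) (γ : ⟦ Γ ⟧) → Saturation (R⟨ b ⟩ γ) (IndR γ b b)

    TotallySaturated : Set ℓ
    TotallySaturated = (∀ S → Saturatedᴿ S) × (∀ K → Saturatedᴬ K) × (∀ K → Saturatedᴼ K)

  record SatMod {ℓ t : Level} (𝓗 : HoTT ℓ) (𝕋 : Theory t) : Set (lsuc ℓ ⊔ t) where
    field
      str       : Str ℓ
      model     : IsModel str 𝓗 𝕋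
      saturated : TotallySaturated str
  open SatMod public

  record Homomorphism {ℓ : Level} (𝓜 𝓝 : Str ℓ) : Set ℓ where
    private
      module M = Str 𝓜
      module N = Str 𝓝
    field
      mO : (X : 𝐎) → M.O^ X → N.O^ X
      mA : (K : 𝐀) (o : (X : 𝐎) → K ⇒ X → M.O^ X) → M.A^ K o → N.A^ K (λ X f → mO X (o X f))
      mR : (S : 𝐑) (o : (X : 𝐎) → S ⇒ X → M.O^ X)
           (a : (K : 𝐀) (g : S ⇒ K) → M.A^ K (λ X f → o X (f ∘ g))) →
           M.R^ S o a → N.R^ S (λ X f → mO X (o X f)) (λ K g → mA K _ (a K g))

  sps : ∀ {ℓ} {A B : Set ℓ} → (A → B) → Set ℓ
  sps {B = B} f = (y : B) → fiber f y

  fibsurj : ∀ {ℓ} {𝓜 𝓝 : Str ℓ} → Homomorphism 𝓜 𝓝 → Set ℓ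
  fibsurj m = (∀ X → sps (mO X)) × (∀ K o → sps (mA K o)) × (∀ S o a → sps (mR S o a))
    where open Homomorphism m

  FibSurj : ∀ {ℓ} → Str ℓ → Str ℓ → Set ℓ
  FibSurj 𝓜 𝓝 = Σ[ m ∈ Homomorphism 𝓜 𝓝 ] fibsurj m

  infix 4 _≃ᶠ_
  _≃ᶠ_ : ∀ {ℓ t} {𝓗 : HoTT ℓ} {𝕋 : Theory t} → SatMod 𝓗 𝕋 → SatMod 𝓗 𝕋 → Set (lsuc ℓ ⊔ t)
  _≃ᶠ_ {𝓗 = 𝓗} {𝕋} 𝓜 𝓝 = Σ[ 𝓟 ∈ SatMod 𝓗 𝕋 ] (FibSurj (str 𝓟) (str 𝓜) × FibSurj (str 𝓟) (str 𝓝))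

{-# OPTIONS --without-K #-}
module Submission where

-- In a saturated structure the sorts of level 1 are propositions, those of levels 2 and 3 are sets,
-- and Ind is a proposition. The graph of a split fibred surjection is total in both directions at
-- every sort, so it preserves and reflects Ind: elements with equal images have indistinguishable
-- images, hence are indistinguishable, hence equal. Split fibred surjections of saturated models
-- are thus fibrewise equivalences, and by univalence the pairs (𝓝 , 𝓜 → 𝓝) form a contractible
-- type for each 𝓜. A span 𝓜 ← 𝓟 → 𝓝 can therefore be contracted one leg at a time.

open import Level using (Level; _⊔_) renaming (suc to lsuc)
open import Axiom.UniquenessOfIdentityProofs using (UIP; module Constant⇒UIP; module Decidable⇒UIP)
open import Data.List using (List; []; _∷_; allFin; map; concatMap)
open import Data.List.Membership.Propositional using (_∈_; lose)
open import Data.List.Membership.Propositional.Properties using (∈-allFin; ∈-concatMap⁺; ∈-map⁺)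
open import Data.List.Relation.Unary.Any using (here; there)
open import Data.List.Relation.Unary.All as All using (All; []; _∷_)
open import Data.Nat using (_≟_)
open import Data.Product using (Σ; Σ-syntax; ∃; _×_; _,_; proj₁; proj₂)
open import Data.Sum using (_⊎_; inj₁; inj₂)
open import Data.Unit.Polymorphic using (⊤; tt)
open import Function.Base using (id; flip)
open import Function.Bundles using (_⇔_; mk⇔; mk↔ₛ′; module Equivalence)
open import Function.Construct.Symmetry using (⇔-sym)
open import Function.Properties.Inverse.HalfAdjointEquivalence using (↔⇒≃) renaming (_≃_ to HalfAdjoint)
open import Relation.Binary.PropositionalEquality
  using (_≡_; refl; sym; trans; cong; cong₂; subst; trans-symˡ; subst-subst-sym)
open import Relation.Nullary using (Dec; yes; no; contradiction)
open import Defs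

open Equivalence using (to; from)

private
  variable
    a b c : Level
    A X X′ Y Y′ : Set a
    B : A → Set b

-- Propositions, equality in Σ-types, and equivalences.

isProp⇒UIP : isProp A → UIP A
isProp⇒UIP p = Constant⇒UIP.≡-irrelevant (λ _ → p _ _) (λ _ _ → refl)

×-isProp : {B : Set b} → isProp A → (A → isProp B) → isProp (A × B)
×-isProp p q (x , y) (x′ , y′) = cong₂ _,_ (p x x′) (q x y y′)

Σ-≡ : (∀ x → isProp (B x)) → {u v : Σ A B} → proj₁ u ≡ proj₁ v → u ≡ v
Σ-≡ p {x , y} {.x , y′} refl = cong (x ,_) (p x y y′)

-- Contracting the fibres needs the two inverse laws to satisfy a triangle identity. Passing to a
-- half adjoint equivalence provides it as `left-right`, which is the condition under which
-- `left-inverse-of x` lifts to a path in the fibre.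
inverse⇒isEquiv : {f : X → Y} (g : Y → X) → (∀ x → g (f x) ≡ x) → (∀ y → f (g y) ≡ y) → isEquiv f
inverse⇒isEquiv {X = X} {Y = Y} {f = f} g gf fg y = (g y , right-inverse-of y) , contract
  where
  open HalfAdjoint (↔⇒≃ (mk↔ₛ′ f g fg gf)) using (left-inverse-of; right-inverse-of; left-right)

  fiber-≡ : ∀ {x₁ x} (p : x₁ ≡ x) {e : f x₁ ≡ f x} → cong f p ≡ e →
            _≡_ {A = fiber f (f x)} (x₁ , e) (x , refl)
  fiber-≡ refl refl = refl

  contract : ∀ {y} (w : fiber f y) → (g y , right-inverse-of y) ≡ w
  contract (x , refl) = fiber-≡ (left-inverse-of x) (left-right x)

-- Any point of a fibre agrees with the chosen one by injectivity, and the accompanying equations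
-- agree because `Y` is a set.
splitInjection⇒isEquiv : UIP Y → {f : X → Y} → (∀ x x′ → f x ≡ f x′ → x ≡ x′) → (∀ y → fiber f y) → isEquiv f
splitInjection⇒isEquiv Y-set f-inj s y =
  s y , λ (x , e) → Σ-≡ (λ _ → Y-set) (f-inj _ x (trans (proj₂ (s y)) (sym e)))

-- Consequences of function extensionality and univalence.

module Foundations {ℓ : Level} (𝓗 : HoTT ℓ) where
  open HoTT 𝓗

  Π-isProp : (∀ x → isProp (B x)) → isProp ((x : A) → B x)
  Π-isProp p f g = funext λ x → p x (f x) (g x)

  -- A contraction makes `A` a proposition, hence a set, so contractions to a fixed centre form a
  -- proposition.
  isContr-isProp : isProp (isContr A)
  isContr-isProp (x , p) (y , q) =
    Σ-≡ (λ _ → Π-isProp λ _ → isProp⇒UIP λ u v → trans (sym (p u)) (p v)) (p y)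

  isEquiv-isProp : {f : X → Y} → isProp (isEquiv f)
  isEquiv-isProp = Π-isProp λ _ → isContr-isProp

  module _ {A : Set a} {B : A → Set b} {C : (x : A) → B x → Set c} where

    private
      -- Pointwise, an endpoint with a path to it ranges over a singleton. Applying `funext` to the
      -- function of such pairs moves the endpoint and the homotopy together.
      raw-contract : {φ ψ : ∀ x y → C x y} (h : ∀ x y → φ x y ≡ ψ x y) →
                     _≡_ {A = Σ[ ψ ∈ (∀ x y → C x y) ] (∀ x y → φ x y ≡ ψ x y)}
                         (φ , λ _ _ → refl) (ψ , h)
      raw-contract {φ} {ψ} h =
        cong (λ k → (λ x y → proj₁ (k x y)) , (λ x y → proj₂ (k x y))) singletons
        where
        singleton : ∀ {x y} {z : C x y} (e : φ x y ≡ z) →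
                    _≡_ {A = Σ[ z ∈ C x y ] φ x y ≡ z} (φ x y , refl) (z , e)
        singleton refl = refl
        singletons : (λ x y → φ x y , refl) ≡ (λ x y → ψ x y , h x y)
        singletons = funext λ x → funext λ y → singleton (h x y)

    -- The correction term compensates that the assumed funext need not send the constant homotopy
    -- to refl.
    homotopies-contract : {φ ψ : ∀ x y → C x y} (h : ∀ x y → φ x y ≡ ψ x y) →
                          _≡_ {A = Σ[ ψ ∈ (∀ x y → C x y) ] (∀ x y → φ x y ≡ ψ x y)}
                              (φ , λ _ _ → refl) (ψ , h)
    homotopies-contract h = trans (sym (raw-contract λ _ _ → refl)) (raw-contract h)

    -- Serves to replace a boundary, which is a function of a sort and an arrow, by a pointwise
    -- equal one together with the homotopy.
    homotopy-induction : {φ : ∀ x y → C x y} (P : (ψ : ∀ x y → C x y) → (∀ x y → φ x y ≡ ψ x y) → Set ℓ) →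
                         P φ (λ _ _ → refl) → ∀ {ψ} h → P ψ h
    homotopy-induction P p h = subst (λ (ψ , h) → P ψ h) (homotopies-contract h) p

    funext₂ : {φ ψ : ∀ x y → C x y} → (∀ x y → φ x y ≡ ψ x y) → φ ≡ ψ
    funext₂ h = cong proj₁ (homotopies-contract h)

    -- Thanks to the correction term, the contraction at the constant homotopy has the form
    -- `trans (sym p) p`.
    funext₂-refl : {φ : ∀ x y → C x y} → funext₂ (λ x y → refl {x = φ x y}) ≡ refl
    funext₂-refl {φ} = cong (cong proj₁) (trans-symˡ (raw-contract λ x y → refl {x = φ x y}))

  -- Univalence presents each `f i` as `idtoeqv q`, and path induction on `q` identifies it with the
  -- identity. The arbitrary index type lets all sorts of a level, with all their boundaries, be
  -- treated at once.
  equivalence-induction :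
    {I : Set a} {A : I → Set ℓ} (P : (B : I → Set ℓ) → (∀ i → A i → B i) → Set c) →
    P A (λ _ x → x) → ∀ {B} {f : ∀ i → A i → B i} → (∀ i → isEquiv (f i)) → P B f
  equivalence-induction {A = A} P p {B} {f} f-equiv =
    subst (λ k → P (λ i → proj₁ (k i)) (λ i → proj₂ (k i))) (funext identified) p
    where
    from-path : ∀ {X Y : Set ℓ} (q : X ≡ Y) → _≡_ {A = Σ[ Z ∈ Set ℓ ] (X → Z)} (X , id) (Y , proj₁ (idtoeqv q))
    from-path refl = refl
    identified : ∀ i → _≡_ {A = Σ[ Z ∈ Set ℓ ] (A i → Z)} (A i , id) (B i , f i)
    identified i with proj₁ (univalence (A i) (B i) (f i , f-equiv i))
    ... | q , e = trans (from-path q) (cong (λ E → B i , proj₁ E) e)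

module _ (𝓛 : FOLDSSignature) where

  open FOLDSSignature 𝓛 hiding (id)
  open FOLDS 𝓛

  -- Enumeration of the arrows out of a sort.

  arrowsTo : ∀ {m n} (K : SortAt m) (K′ : Sort) → Dec (level K′ ≡ n) → List (Σ[ K′ ∈ SortAt n ] K ⇒ K′)
  arrowsTo K K′ (yes e) = map (at-level K′ e ,_) (allFin _)
  arrowsTo K K′ (no _)  = []

  allArrows : ∀ {m} (K : SortAt m) n → List (Σ[ K′ ∈ SortAt n ] K ⇒ K′)
  allArrows K n = concatMap (λ K′ → arrowsTo K K′ (level K′ ≟ n)) (allFin _)

  -- The decision is an explicit argument so that it can be split on. In the positive case its proof
  -- agrees with the one stored in `K′`, since equality of natural numbers is a proposition.
  ∈-arrowsTo : ∀ {m n} (K : SortAt m) (K′ : SortAt n) (f : K ⇒ K′) (d : Dec (level (sort K′) ≡ n)) →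
               (K′ , f) ∈ arrowsTo K (sort K′) d
  ∈-arrowsTo K (at-level K′ e) f (no l≢n) = contradiction e l≢n
  ∈-arrowsTo K (at-level K′ e) f (yes e′) with Decidable⇒UIP.≡-irrelevant _≟_ e e′
  ... | refl = ∈-map⁺ _ (∈-allFin f)

  ∈-allArrows : ∀ {m n} (K : SortAt m) (K′ : SortAt n) (f : K ⇒ K′) → (K′ , f) ∈ allArrows K n
  ∈-allArrows {n = n} K K′ f =
    ∈-concatMap⁺ _ (lose (∈-allFin (sort K′)) (∈-arrowsTo K K′ f (level (sort K′) ≟ n)))

  -- Boundaries in a structure as values of variables.

  module Realisation {ℓ : Level} (𝓗 : HoTT ℓ) (𝓜 : Str ℓ) where
    open HoTT 𝓗
    open Foundations 𝓗
    open Str 𝓜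

    -- Every listed arrow receives a variable of its own, even where values of `o` coincide. Sorts
    -- of level 3 have empty boundary, so the declarations are independent of each other.
    realise-O : ∀ {n} (S : SortAt n) (o : (X : 𝐎) → S ⇒ X → O^ X) (xs : List (Σ[ X ∈ 𝐎 ] S ⇒ X)) →
                Σ[ Γ ∈ Ctx ] Σ[ γ ∈ ⟦ 𝓜 ⟧ Γ ]
                All (λ (X , f) → Σ[ v ∈ VarO Γ X ] ⟦ 𝓜 ⟧ᴼ v γ ≡ o X f) xs
    realise-O S o [] = ∅ , tt , []
    realise-O S o ((X , f) ∷ xs) =
      let Γ , γ , vs = realise-O S o xs
      in Γ ▹ decO X , (γ , o X f) , (here , refl) ∷ All.map (λ (v , e) → there v , e) vs

    -- Saturation speaks of boundaries given by variables of a context; as the signature is finite,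
    -- every boundary in the structure arises in this way.
    O-boundary-induction :
      ∀ {n} (S : SortAt n) (P : ((X : 𝐎) → S ⇒ X → O^ X) → Set ℓ) →
      ((Γ : Ctx) (v : (X : 𝐎) → S ⇒ X → VarO Γ X) (γ : ⟦ 𝓜 ⟧ Γ) → P (λ X f → ⟦ 𝓜 ⟧ᴼ (v X f) γ)) →
      ∀ o → P o
    O-boundary-induction S P p o =
      let Γ , γ , vs = realise-O S o (allArrows S 3)
          v = λ X f → All.lookup vs (∈-allArrows S X f)
      in subst P (funext λ X → funext λ f → proj₂ (v X f)) (p Γ (λ X f → proj₁ (v X f)) γ)

    Boundaryᴿ-predicate : 𝐑 → Set (lsuc ℓ)
    Boundaryᴿ-predicate S =
      (o : (X : 𝐎) → S ⇒ X → O^ X) → ((K : 𝐀) (g : S ⇒ K) → A^ K (λ X f → o X (f ∘ g))) → Set ℓ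

    module _ {S : 𝐑} (P : Boundaryᴿ-predicate S)
             (p : ∀ Γ (b : BdryR Γ S) γ → P (λ X f → ⟦ 𝓜 ⟧ᴼ (onO b X f) γ) (λ K g → ⟦ 𝓜 ⟧ᴬ (onA b K g) γ)) where

      -- Induction on a worklist: each arrow is either still pending or already has a variable with
      -- the required value. Declaring a further variable leaves the values of the earlier ones
      -- definitionally unchanged, so `a` keeps its type.
      realise-A :
        ∀ {Γ} (v : (X : 𝐎) → S ⇒ X → VarO Γ X) (γ : ⟦ 𝓜 ⟧ Γ)
        (a : (K : 𝐀) (g : S ⇒ K) → A^ K (λ X f → ⟦ 𝓜 ⟧ᴼ (v X (f ∘ g)) γ)) (pending : List (Σ[ K ∈ 𝐀 ] S ⇒ K)) →
        ((K : 𝐀) (g : S ⇒ K) →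
          (K , g) ∈ pending ⊎ (Σ[ w ∈ VarA Γ K (bdryA (λ X f → v X (f ∘ g))) ] ⟦ 𝓜 ⟧ᴬ w γ ≡ a K g)) →
        P (λ X f → ⟦ 𝓜 ⟧ᴼ (v X f) γ) a
      realise-A {Γ} v γ a [] assigned =
        subst (P _) (funext λ K → funext λ g → proj₂ (w K g)) (p Γ (bdryR v (λ K g → proj₁ (w K g))) γ)
        where
        w : ∀ K g → Σ[ w ∈ VarA Γ K (bdryA (λ X f → v X (f ∘ g))) ] ⟦ 𝓜 ⟧ᴬ w γ ≡ a K g
        w K g with assigned K g
        ... | inj₂ w = w
      realise-A v γ a ((K , g) ∷ pending) assigned =
        realise-A {Γ = _ ▹ decA K (bdryA (λ X f → v X (f ∘ g)))} (λ X f → there (v X f)) (γ , a K g) a pending assigned′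
        where
        assigned′ : ∀ K′ g′ → _
        assigned′ K′ g′ with assigned K′ g′
        ... | inj₁ (here refl) = inj₂ (here , refl)
        ... | inj₁ (there q)   = inj₁ q
        ... | inj₂ (w , e)     = inj₂ (there w , e)

      R-boundary-induction : ∀ o a → P o a
      R-boundary-induction =
        O-boundary-induction S (λ o → ∀ a → P o a) λ Γ v γ a →
          realise-A v γ a (allArrows S 2) (λ K g → inj₁ (∈-allArrows S K g))

    -- Propositions and sets in saturated structures.

    ⊨-isProp : ∀ {Γ} (γ : ⟦ 𝓜 ⟧ Γ) (φ : Formula Γ) → isProp (_⊨_ 𝓜 𝓗 γ φ)
    ⊨-isProp γ ⊤′       = λ _ _ → refl
    ⊨-isProp γ ⊥′       = λ ()
    ⊨-isProp γ (φ ∧′ ψ) = ×-isProp (⊨-isProp γ φ) (λ _ → ⊨-isProp γ ψ)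
    ⊨-isProp γ (φ ∨′ ψ) = squash
    ⊨-isProp γ (φ ⇒′ ψ) = Π-isProp λ _ → ⊨-isProp γ ψ
    ⊨-isProp γ (∀′ D φ) = Π-isProp λ d → ⊨-isProp (γ , d) φ
    ⊨-isProp γ (∃′ D φ) = squash

    IsModel-isProp : ∀ {t} (𝕋 : Theory t) → isProp (IsModel 𝓜 𝓗 𝕋)
    IsModel-isProp 𝕋 = Π-isProp λ φ → Π-isProp λ _ → ⊨-isProp tt φ

    Π⟨⟩-isProp : ∀ {Γ Θ} (e : Γ ⊑ Θ) γ {P : ⟦ 𝓜 ⟧ Θ → Set ℓ} → (∀ θ → isProp (P θ)) → isProp (Π⟨ 𝓜 ⟩ e γ P)
    Π⟨⟩-isProp done       γ p = p γ
    Π⟨⟩-isProp (more e D) γ p = Π⟨⟩-isProp e γ (λ θ → Π-isProp λ d → p (θ , d))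

    module _ {X : Set ℓ} {_≅_ : X → X → Set ℓ} where

      iso⇒≡ : Saturation 𝓜 X _≅_ → ∀ {x y} → x ≅ y → x ≡ y
      iso⇒≡ (_ , e) i = proj₁ (proj₁ (e _ _ i))

      -- Hedberg's argument: going through the proposition `x ≅ y` and back is a constant endomap of
      -- `x ≡ y`.
      Saturation⇒UIP : (∀ x y → isProp (x ≅ y)) → Saturation 𝓜 X _≅_ → UIP X
      Saturation⇒UIP p s = Constant⇒UIP.≡-irrelevant
        (λ q → iso⇒≡ s (idtoiso 𝓜 (proj₁ s) _ _ q))
        (λ q r → cong (iso⇒≡ s) (p _ _ _ _))

      Saturation-isProp : (∀ x y → isProp (x ≅ y)) → isProp (Saturation 𝓜 X _≅_)
      Saturation-isProp p (r , e) (r′ , e′) =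
        Σ-≡ (λ _ → Π-isProp λ _ → Π-isProp λ _ → isEquiv-isProp) (Π-isProp (λ x → p x x) r r′)

    -- If Ind relates both x and x′ to y, then x ≅ x′ because y ≅ y; so the second factor of Bij
    -- makes the third one a proposition.
    Bij-isProp :
      ∀ {X Y : Set ℓ} {Ind : X → Y → Set ℓ} {_≅X_ : X → X → Set ℓ} {_≅Y_ : Y → Y → Set ℓ} →
      (∀ x y → isProp (Ind x y)) → (∀ x x′ → isProp (x ≅X x′)) → (∀ y y′ → isProp (y ≅Y y′)) →
      Saturation 𝓜 X _≅X_ → Saturation 𝓜 Y _≅Y_ → isProp (Bij 𝓜 X Y Ind _≅X_ _≅Y_)
    Bij-isProp Ind-p ≅X-p ≅Y-p sX sY =
      ×-isProp
        (Π-isProp λ x (y , i , u) (y′ , i′ , u′) →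
          Σ-≡ (λ y → ×-isProp (Ind-p x y) (λ _ → Π-isProp λ _ → Π-isProp λ _ → ≅Y-p _ _))
              (iso⇒≡ sY (u y′ i′)))
        λ _ → ×-isProp
          (Π-isProp λ _ → Π-isProp λ _ → Π-isProp λ _ → Π-isProp λ _ → Π-isProp λ _ → ≅X-p _ _)
          λ c → Π-isProp λ y (x , i) (x′ , i′) →
            Σ-≡ (λ x → Ind-p x y) (iso⇒≡ sX (c x x′ y y (i , i′ , proj₁ sY y)))

    ⊤-isProp : isProp (⊤ {ℓ})
    ⊤-isProp _ _ = refl

    Saturatedᴿ-isProp : isProp (∀ S → Saturatedᴿ 𝓜 S)
    Saturatedᴿ-isProp =
      Π-isProp λ S → Π-isProp λ Γ → Π-isProp λ b → Π-isProp λ γ → Saturation-isProp λ _ _ → ⊤-isProp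

    module _ (sᴿ : ∀ S → Saturatedᴿ 𝓜 S) where

      -- `IndR` is the unit type, so saturation identifies any two elements over a boundary given by
      -- variables; boundary induction covers the remaining boundaries.
      R^-isProp : ∀ S o a → isProp (R^ S o a)
      R^-isProp S = R-boundary-induction (λ o a → isProp (R^ S o a)) λ Γ b γ x y → iso⇒≡ (sᴿ S Γ b γ) tt

      BijR-isProp : ∀ {Γ S} γ (α β : BdryR Γ S) → isProp (BijR 𝓜 γ α β)
      BijR-isProp {S = S} γ α β =
        Bij-isProp (λ _ _ → ⊤-isProp) (λ _ _ → ⊤-isProp) (λ _ _ → ⊤-isProp) (sᴿ S _ α γ) (sᴿ S _ β γ)

      -- `BijR` contains untruncated sums, but saturation at level 1 makes it a proposition. The
      -- same step one level up yields `IndO-isProp`.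
      IndA-isProp : ∀ {Γ K} γ (α β : BdryA Γ K) x y → isProp (IndA 𝓜 γ α β x y)
      IndA-isProp γ α β x y =
        Π-isProp λ S → Π-isProp λ _ → Π-isProp λ _ → Π-isProp λ p → Π-isProp λ π →
          Π⟨⟩-isProp (Pair.ext π) _ λ θ → BijR-isProp θ (Pair.α π) (Pair.β π)

      Saturatedᴬ-isProp : isProp (∀ K → Saturatedᴬ 𝓜 K)
      Saturatedᴬ-isProp =
        Π-isProp λ K → Π-isProp λ Γ → Π-isProp λ b → Π-isProp λ γ → Saturation-isProp (IndA-isProp γ b b)

      module _ (sᴬ : ∀ K → Saturatedᴬ 𝓜 K) where

        A^-isSet : ∀ K o → UIP (A^ K o)
        A^-isSet K o {x} {y} p q =
          O-boundary-induction K (λ o → (x y : A^ K o) → isProp (x ≡ y))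
            (λ Γ v γ _ _ → Saturation⇒UIP (IndA-isProp γ (bdryA v) (bdryA v)) (sᴬ K Γ (bdryA v) γ))
            o x y p q

        BijA-isProp : ∀ {Γ K} γ (α β : BdryA Γ K) → isProp (BijA 𝓜 γ α β)
        BijA-isProp {K = K} γ α β =
          Bij-isProp (IndA-isProp γ α β) (IndA-isProp γ α α) (IndA-isProp γ β β) (sᴬ K _ α γ) (sᴬ K _ β γ)

        BijLower-isProp : ∀ {Γ} S γ (α β : Bdry Γ S) → isProp (BijLower 𝓜 S γ α β)
        BijLower-isProp (lowA K) = BijA-isProp
        BijLower-isProp (lowR S) = BijR-isProp

        IndO-isProp : ∀ K x y → isProp (IndO 𝓜 K x y)
        IndO-isProp K x y =
          Π-isProp λ S → Π-isProp λ p → Π-isProp λ π →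
            Π⟨⟩-isProp (Pair.ext π) _ λ θ → BijLower-isProp S θ (Pair.α π) (Pair.β π)

        Saturatedᴼ-isProp : isProp (∀ K → Saturatedᴼ 𝓜 K)
        Saturatedᴼ-isProp = Π-isProp λ K → Saturation-isProp (IndO-isProp K)

        O^-isSet : (∀ K → Saturatedᴼ 𝓜 K) → ∀ K → UIP (O^ K)
        O^-isSet sᴼ K = Saturation⇒UIP (IndO-isProp K) (sᴼ K)

    -- At each level propositionality relies on saturation at the levels below, which the dependent
    -- form of `×-isProp` makes available.
    TotallySaturated-isProp : isProp (TotallySaturated 𝓜)
    TotallySaturated-isProp =
      ×-isProp Saturatedᴿ-isProp λ sᴿ → ×-isProp (Saturatedᴬ-isProp sᴿ) λ sᴬ → Saturatedᴼ-isProp sᴿ sᴬ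

  -- Transfer of indistinguishability along relations total in both directions.

  Total : ∀ {x y r} {X : Set x} {Y : Set y} → (X → Y → Set r) → Set (x ⊔ y ⊔ r)
  Total R = (∀ x → ∃ λ y → R x y) × (∀ y → ∃ λ x → R x y)

  module _ {ℓ : Level} (𝓜 𝓝 : Str ℓ)
           {X X′ Y Y′ : Set ℓ}
           {Ind : X → Y → Set ℓ} {_≅X_ : X → X → Set ℓ} {_≅Y_ : Y → Y → Set ℓ}
           {Ind′ : X′ → Y′ → Set ℓ} {_≅X′_ : X′ → X′ → Set ℓ} {_≅Y′_ : Y′ → Y′ → Set ℓ}
           {_~X_ : X → X′ → Set ℓ} {_~Y_ : Y → Y′ → Set ℓ} where

    -- Given elements are pulled back to related ones, the original `Bij` is applied, and its
    -- results are pushed forward. Any choice of related elements will do, since the equivalences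
    -- hold for all related pairs.
    Bij-transfer :
      Total _~X_ → Total _~Y_ →
      (∀ {x x′ y y′} → x ~X x′ → y ~Y y′ → Ind x y ⇔ Ind′ x′ y′) →
      (∀ {x x′ z z′} → x ~X x′ → z ~X z′ → (x ≅X z) ⇔ (x′ ≅X′ z′)) →
      (∀ {y y′ z z′} → y ~Y y′ → z ~Y z′ → (y ≅Y z) ⇔ (y′ ≅Y′ z′)) →
      Bij 𝓜 X Y Ind _≅X_ _≅Y_ → Bij 𝓝 X′ Y′ Ind′ _≅X′_ _≅Y′_
    Bij-transfer (X→ , X←) (Y→ , Y←) Ind⇔ ≅X⇔ ≅Y⇔ (exists , injective , onto) =
        (λ x′ →
          let x , rx = X← x′
              y , i , unique = exists x
              y′ , ry = Y→ y
          in y′ , to (Ind⇔ rx ry) i , λ z′ i′ →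
            let z , rz = Y← z′ in to (≅Y⇔ ry rz) (unique z (from (Ind⇔ rx rz) i′)))
      , (λ x′ z′ y′ w′ (i , j , k) →
          let x , rx = X← x′
              z , rz = X← z′
              y , ry = Y← y′
              w , rw = Y← w′
          in to (≅X⇔ rx rz)
               (injective x z y w (from (Ind⇔ rx ry) i , from (Ind⇔ rz rw) j , from (≅Y⇔ ry rw) k)))
      , (λ y′ →
          let y , ry = Y← y′
              x , i = onto y
              x′ , rx = X→ x
          in x′ , to (Ind⇔ rx ry) i)

  module _ {ℓ : Level} (𝓜 𝓝 : Str ℓ)
           {X X′ Y Y′ : Set ℓ}
           {Ind : X → Y → Set ℓ} {_≅X_ : X → X → Set ℓ} {_≅Y_ : Y → Y → Set ℓ}
           {Ind′ : X′ → Y′ → Set ℓ} {_≅X′_ : X′ → X′ → Set ℓ} {_≅Y′_ : Y′ → Y′ → Set ℓ}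
           {_~X_ : X → X′ → Set ℓ} {_~Y_ : Y → Y′ → Set ℓ} where

    Bij-⇔ :
      Total _~X_ → Total _~Y_ →
      (∀ {x x′ y y′} → x ~X x′ → y ~Y y′ → Ind x y ⇔ Ind′ x′ y′) →
      (∀ {x x′ z z′} → x ~X x′ → z ~X z′ → (x ≅X z) ⇔ (x′ ≅X′ z′)) →
      (∀ {y y′ z z′} → y ~Y y′ → z ~Y z′ → (y ≅Y z) ⇔ (y′ ≅Y′ z′)) →
      Bij 𝓜 X Y Ind _≅X_ _≅Y_ ⇔ Bij 𝓝 X′ Y′ Ind′ _≅X′_ _≅Y′_
    Bij-⇔ tX tY Ind⇔ ≅X⇔ ≅Y⇔ = mk⇔
      (Bij-transfer 𝓜 𝓝 tX tY Ind⇔ ≅X⇔ ≅Y⇔)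
      (Bij-transfer 𝓝 𝓜 {_~X_ = flip _~X_} {_~Y_ = flip _~Y_} (proj₂ tX , proj₁ tX) (proj₂ tY , proj₁ tY)
        (λ rx ry → ⇔-sym (Ind⇔ rx ry)) (λ rx rz → ⇔-sym (≅X⇔ rx rz)) (λ ry rz → ⇔-sym (≅Y⇔ ry rz)))

  -- Related elements rather than a homomorphism: the image of a variable's value is then related
  -- to that variable's value on the nose, without transport along an equation between boundaries.
  record Bisimulation {ℓ : Level} (𝓜 𝓝 : Str ℓ) : Set (lsuc ℓ) where
    private
      module M = Str 𝓜
      module N = Str 𝓝
    field
      relO : (X : 𝐎) → M.O^ X → N.O^ X → Set ℓ
      relA : (K : 𝐀) {o : (X : 𝐎) → K ⇒ X → M.O^ X} {o′ : (X : 𝐎) → K ⇒ X → N.O^ X} →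
             (∀ X f → relO X (o X f) (o′ X f)) → M.A^ K o → N.A^ K o′ → Set ℓ
      totalO : ∀ X → Total (relO X)
      totalA : ∀ K {o : (X : 𝐎) → K ⇒ X → M.O^ X} {o′ : (X : 𝐎) → K ⇒ X → N.O^ X}
               (ro : ∀ X f → relO X (o X f) (o′ X f)) → Total (relA K ro)
      R⇔ : ∀ S {o : (X : 𝐎) → S ⇒ X → M.O^ X} {o′ : (X : 𝐎) → S ⇒ X → N.O^ X}
           (ro : ∀ X f → relO X (o X f) (o′ X f)) {a a′} →
           (∀ K g → relA K (λ X f → ro X (f ∘ g)) (a K g) (a′ K g)) →
           M.R^ S o a ⇔ N.R^ S o′ a′

    Rel  : ∀ Γ → ⟦ 𝓜 ⟧ Γ → ⟦ 𝓝 ⟧ Γ → Set ℓ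
    Relᴰ : ∀ {Γ} (D : Decl Γ) {γ γ′} → Rel Γ γ γ′ → ⟦ 𝓜 ⟧ᴰ D γ → ⟦ 𝓝 ⟧ᴰ D γ′ → Set ℓ
    relᴼ : ∀ {Γ X} (v : VarO Γ X) {γ γ′} (r : Rel Γ γ γ′) → relO X (⟦ 𝓜 ⟧ᴼ v γ) (⟦ 𝓝 ⟧ᴼ v γ′)

    Rel ∅       _       _         = ⊤
    Rel (Γ ▹ D) (γ , d) (γ′ , d′) = Σ[ r ∈ Rel Γ γ γ′ ] Relᴰ D r d d′

    Relᴰ (decO X)   r     = relO X
    Relᴰ (decA K b) r     = relA K (λ X f → relᴼ (var b X f) r)
    -- Level 1 is compared only up to logical equivalence, so any two elements over related
    -- boundaries count as related.
    Relᴰ (decR S b) r _ _ = ⊤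

    relᴼ here      (r , rd) = rd
    relᴼ (there v) (r , rd) = relᴼ v r

    relᴬ : ∀ {Γ K b} (v : VarA Γ K b) {γ γ′} (r : Rel Γ γ γ′) →
           relA K (λ X f → relᴼ (var b X f) r) (⟦ 𝓜 ⟧ᴬ v γ) (⟦ 𝓝 ⟧ᴬ v γ′)
    relᴬ here      (r , rd) = rd
    relᴬ (there v) (r , rd) = relᴬ v r

    R⟨⟩-⇔ : ∀ {Γ S} (b : BdryR Γ S) {γ γ′} → Rel Γ γ γ′ → R⟨ 𝓜 ⟩ b γ ⇔ R⟨ 𝓝 ⟩ b γ′
    R⟨⟩-⇔ {S = S} b r = R⇔ S (λ X f → relᴼ (onO b X f) r) (λ K g → relᴬ (onA b K g) r)

    Relᴰ-total : ∀ {Γ} (D : Decl Γ) {γ γ′} (r : Rel Γ γ γ′) → Total (Relᴰ D r)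
    Relᴰ-total (decO X)   r = totalO X
    Relᴰ-total (decA K b) r = totalA K _
    Relᴰ-total (decR S b) r = (λ d → to (R⟨⟩-⇔ b r) d , tt) , (λ d → from (R⟨⟩-⇔ b r) d , tt)

    Rel-extends : ∀ Γ γ → ∃ (Rel Γ γ)
    Rel-extends ∅       γ       = tt , tt
    Rel-extends (Γ ▹ D) (γ , d) =
      let γ′ , r  = Rel-extends Γ γ
          d′ , rd = proj₁ (Relᴰ-total D r) d
      in (γ′ , d′) , (r , rd)

    -- Each value of a further variable on one side has a related value on the other, at which the
    -- given product can be evaluated.
    Π⟨⟩-⇔ : ∀ {Γ Θ} (e : Γ ⊑ Θ) {γ γ′} → Rel Γ γ γ′ → {P : ⟦ 𝓜 ⟧ Θ → Set ℓ} {P′ : ⟦ 𝓝 ⟧ Θ → Set ℓ} →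
            (∀ {θ θ′} → Rel Θ θ θ′ → P θ ⇔ P′ θ′) → Π⟨ 𝓜 ⟩ e γ P ⇔ Π⟨ 𝓝 ⟩ e γ′ P′
    Π⟨⟩-⇔ done       r h = h r
    Π⟨⟩-⇔ (more e D) r h = Π⟨⟩-⇔ e r λ s → mk⇔
      (λ q d′ → let d , rd = proj₂ (Relᴰ-total D s) d′ in to (h (s , rd)) (q d))
      (λ q d → let d′ , rd = proj₁ (Relᴰ-total D s) d in from (h (s , rd)) (q d′))

    BijR-⇔ : ∀ {Γ S} {γ γ′} (α β : BdryR Γ S) → Rel Γ γ γ′ → BijR 𝓜 γ α β ⇔ BijR 𝓝 γ′ α β
    BijR-⇔ α β r = Bij-⇔ 𝓜 𝓝 (Relᴰ-total (decR _ α) r) (Relᴰ-total (decR _ β) r) trivial trivial trivial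
      where
      trivial : ∀ {X Y : Set ℓ} → X → Y → ⊤ {ℓ} ⇔ ⊤ {ℓ}
      trivial _ _ = mk⇔ id id

    -- The index set of the conjunction, including membership in `In𝓛`, is purely syntactic, so the
    -- two structures can be compared conjunct by conjunct.
    IndA-⇔ : ∀ {Γ K} {γ γ′} (α β : BdryA Γ K) (r : Rel Γ γ γ′) →
             ∀ {x x′ y y′} → Relᴰ (decA K α) r x x′ → Relᴰ (decA K β) r y y′ →
             IndA 𝓜 γ α β x y ⇔ IndA 𝓝 γ′ α β x′ y′
    IndA-⇔ {Γ} {K} {γ} {γ′} α β r {x} {x′} {y} {y′} rx ry = mk⇔
      (λ ind S i j p π → to (conjunct π) (ind S i j p π))
      (λ ind S i j p π → from (conjunct π) (ind S i j p π))
      where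
      conjunct : ∀ {S p} (π : PairA Γ K α β S p) →
                 Π⟨ 𝓜 ⟩ (Pair.ext π) ((γ , x) , y) (λ θ → BijR 𝓜 θ (Pair.α π) (Pair.β π)) ⇔
                 Π⟨ 𝓝 ⟩ (Pair.ext π) ((γ′ , x′) , y′) (λ θ → BijR 𝓝 θ (Pair.α π) (Pair.β π))
      conjunct π = Π⟨⟩-⇔ (Pair.ext π) ((r , rx) , ry) (BijR-⇔ (Pair.α π) (Pair.β π))

    BijA-⇔ : ∀ {Γ K} {γ γ′} (α β : BdryA Γ K) → Rel Γ γ γ′ → BijA 𝓜 γ α β ⇔ BijA 𝓝 γ′ α β
    BijA-⇔ α β r =
      Bij-⇔ 𝓜 𝓝 (Relᴰ-total (decA _ α) r) (Relᴰ-total (decA _ β) r) (IndA-⇔ α β r) (IndA-⇔ α α r) (IndA-⇔ β β r)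

    BijLower-⇔ : ∀ {Γ} S {γ γ′} (α β : Bdry Γ S) → Rel Γ γ γ′ → BijLower 𝓜 S γ α β ⇔ BijLower 𝓝 S γ′ α β
    BijLower-⇔ (lowA K) = BijA-⇔
    BijLower-⇔ (lowR S) = BijR-⇔

    IndO-reflect : ∀ K {x x′ y y′} → relO K x x′ → relO K y y′ → IndO 𝓝 K x′ y′ → IndO 𝓜 K x y
    IndO-reflect K rx ry ind S p π =
      from (Π⟨⟩-⇔ (Pair.ext π) ((tt , rx) , ry) (BijLower-⇔ S (Pair.α π) (Pair.β π))) (ind S p π)

  module _ {ℓ : Level} (𝓗 : HoTT ℓ) where
    open HoTT 𝓗
    open Foundations 𝓗

    -- Split fibred surjections between saturated structures are equivalences.

    idF : (𝓜 : Str ℓ) → FibSurj 𝓜 𝓜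
    idF 𝓜 = record { mO = λ _ x → x ; mA = λ _ _ x → x ; mR = λ _ _ _ x → x }
          , (λ _ y → y , refl) , (λ _ _ y → y , refl) , (λ _ _ _ y → y , refl)

    module _ {𝓜 𝓝 : Str ℓ} (m : Homomorphism 𝓜 𝓝) (surj : fibsurj m) where
      open Homomorphism m
      private
        module M = Str 𝓜
        module N = Str 𝓝

      -- The image of `a` lies over the image of its boundary, hence the transport along the
      -- boundary homotopy before the comparison with `a′`.
      graphA : (K : 𝐀) {o : (X : 𝐎) → K ⇒ X → M.O^ X} {o′ : (X : 𝐎) → K ⇒ X → N.O^ X} →
               (∀ X f → mO X (o X f) ≡ o′ X f) → M.A^ K o → N.A^ K o′ → Set ℓ
      graphA K {o} ro a a′ = subst (N.A^ K) (funext₂ ro) (mA K o a) ≡ a′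

      graphA-refl : ∀ K {o} {a : M.A^ K o} {a′} → graphA K (λ _ _ → refl) a a′ → mA K o a ≡ a′
      graphA-refl K {a = a} {a′} = subst (λ e → subst (N.A^ K) e (mA K _ a) ≡ a′) funext₂-refl

      graph : Bisimulation 𝓜 𝓝
      graph = record
        { relO   = λ X x x′ → mO X x ≡ x′
        ; relA   = graphA
        ; totalO = λ X → (λ x → mO X x , refl) , proj₁ surj X
        ; totalA = λ K {o} ro → (λ a → _ , refl) , λ a′ →
            -- The splitting is applied to `a′` transported back over the image of `o`.
            let a , e = proj₁ (proj₂ surj) K o (subst (N.A^ K) (sym (funext₂ ro)) a′)
            in a , trans (cong (subst (N.A^ K) (funext₂ ro)) e) (subst-subst-sym (funext₂ ro))
        ; R⇔     = R-⇔
        }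
        where
        R-⇔ : ∀ S {o o′} (ro : ∀ X f → mO X (o X f) ≡ o′ X f) {a a′} →
              (∀ K g → graphA K (λ X f → ro X (f ∘ g)) (a K g) (a′ K g)) → M.R^ S o a ⇔ N.R^ S o′ a′
        -- For constant `ro`, `graphA-refl` makes the hypothesis a family of plain equations, so
        -- `a′` may be taken to be the image of `a`. Then `mR` and its splitting are the two
        -- directions.
        R-⇔ S {o} ro {a} = homotopy-induction
          (λ o′ ro → ∀ {a′ : ∀ K g → N.A^ K (λ X f → o′ X (f ∘ g))} →
            (∀ K g → graphA K (λ X f → ro X (f ∘ g)) (a K g) (a′ K g)) → M.R^ S o a ⇔ N.R^ S o′ a′)
          (λ ra → subst (λ a′ → M.R^ S o a ⇔ N.R^ S _ a′) (funext₂ λ K g → graphA-refl K (ra K g))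
            (mk⇔ (mR S o a) (λ r → proj₁ (proj₂ (proj₂ surj) S o a r))))
          ro

      module _ (sM : TotallySaturated 𝓜) (sN : TotallySaturated 𝓝) where
        open Bisimulation graph
        private
          module RM = Realisation 𝓗 𝓜
          module RN = Realisation 𝓗 𝓝

        mO-injective : ∀ X x y → mO X x ≡ mO X y → x ≡ y
        mO-injective X x y e =
          -- Both `x` and `y` are related to `mO X y`, so the reflexivity of `IndO` there reflects
          -- to indistinguishability of `x` and `y`.
          RM.iso⇒≡ (proj₂ (proj₂ sM) X) (IndO-reflect X e refl (proj₁ (proj₂ (proj₂ sN) X) (mO X y)))

        mA-injective : ∀ K o x y → mA K o x ≡ mA K o y → x ≡ y
        mA-injective K = RM.O-boundary-induction K (λ o → ∀ x y → mA K o x ≡ mA K o y → x ≡ y)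
          λ Γ v γ x y e →
            let b = bdryA v
                γ′ , r = Rel-extends Γ γ
                y′ , ry = proj₁ (Relᴰ-total (decA K b) r) y
                -- By `e`, the element `y′` related to `y` is related to `x` as well, so reflexivity
                -- at `y′` reflects to `x` and `y`.
                rx = trans (cong (subst (N.A^ K) (funext₂ λ X f → relᴼ (v X f) r)) e) ry
            in RM.iso⇒≡ (proj₁ (proj₂ sM) K Γ b γ)
                 (from (IndA-⇔ b b r rx ry) (proj₁ (proj₁ (proj₂ sN) K Γ b γ′) y′))

        mO-isEquiv : ∀ X → isEquiv (mO X)
        mO-isEquiv X = splitInjection⇒isEquiv
          (RN.O^-isSet (proj₁ sN) (proj₁ (proj₂ sN)) (proj₂ (proj₂ sN)) X)
          (mO-injective X) (proj₁ surj X)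

        mA-isEquiv : ∀ K o → isEquiv (mA K o)
        mA-isEquiv K o = splitInjection⇒isEquiv
          (RN.A^-isSet (proj₁ sN) (proj₁ (proj₂ sN)) K _)
          (mA-injective K o) (proj₁ (proj₂ surj) K o)

        mR-isEquiv : ∀ S o a → isEquiv (mR S o a)
        mR-isEquiv S o a = splitInjection⇒isEquiv
          (isProp⇒UIP (RN.R^-isProp (proj₁ sN) S _ _))
          (λ x y _ → RM.R^-isProp (proj₁ sM) S o a x y) (proj₂ (proj₂ surj) S o a)

    -- Contractibility of the split fibred surjections out of a fixed model.

    module _ (𝓜 : Str ℓ) where
      open Homomorphism
      private module M = Str 𝓜

      -- Levels 3, 2 and 1 are contracted in this order. Each motive quantifies over the data of the
      -- lower levels, whose types depend on the level being contracted, and families are uncurried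
      -- to index them by sort and boundary.
      equivalences-contract :
        (𝓝 : Str ℓ) (m : Homomorphism 𝓜 𝓝) →
        (∀ X → isEquiv (mO m X)) → (∀ K o → isEquiv (mA m K o)) → (∀ S o a → isEquiv (mR m S o a)) →
        _≡_ {A = Σ (Str ℓ) (Homomorphism 𝓜)} (𝓜 , proj₁ (idF 𝓜)) (𝓝 , m)
      equivalences-contract 𝓝 m eO eA eR =
        equivalence-induction
          (λ O f → ∀ {A : ∀ K → ((X : 𝐎) → K ⇒ X → O X) → Set ℓ}
                     {R : ∀ S o → (∀ K g → A K (λ X f → o X (f ∘ g))) → Set ℓ}
                     {mA : ∀ K o → M.A^ K o → A K (λ X g → f X (o X g))} →
                     (∀ K o → isEquiv (mA K o)) →
                     {mR : ∀ S o a → M.R^ S o a → R S (λ X g → f X (o X g)) (λ K g → mA K _ (a K g))} →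
                     (∀ S o a → isEquiv (mR S o a)) →
                     _≡_ {A = Σ (Str ℓ) (Homomorphism 𝓜)} (𝓜 , proj₁ (idF 𝓜))
                       (record { O^ = O ; A^ = A ; R^ = R } , record { mO = f ; mA = mA ; mR = mR }))
          (λ eA → equivalence-induction
            (λ A f → ∀ {R : ∀ S o → (∀ K g → A (K , λ X f → o X (f ∘ g))) → Set ℓ}
                       {mR : ∀ S o a → M.R^ S o a → R S o (λ K g → f _ (a K g))} →
                       (∀ S o a → isEquiv (mR S o a)) →
                       _≡_ {A = Σ (Str ℓ) (Homomorphism 𝓜)} (𝓜 , proj₁ (idF 𝓜))
                         ( record { O^ = M.O^ ; A^ = λ K o → A (K , o) ; R^ = R }
                         , record { mO = λ _ x → x ; mA = λ K o → f (K , o) ; mR = mR }))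
            (λ eR → equivalence-induction
              (λ R f → _≡_ {A = Σ (Str ℓ) (Homomorphism 𝓜)} (𝓜 , proj₁ (idF 𝓜))
                         ( record { O^ = M.O^ ; A^ = M.A^ ; R^ = λ S o a → R (S , o , a) }
                         , record { mO = λ _ x → x ; mA = λ _ _ x → x ; mR = λ S o a → f (S , o , a) }))
              refl (λ (S , o , a) → eR S o a))
            (λ (K , o) → eA K o))
          eO eA eR

      -- Splittings are data in general, but a splitting of an identity map is a family of elements
      -- of singletons.
      fibsurj-idF-isProp : isProp (fibsurj (proj₁ (idF 𝓜)))
      fibsurj-idF-isProp =
        ×-isProp (Π-isProp λ _ → sps-id-isProp) λ _ →
        ×-isProp (Π-isProp λ _ → Π-isProp λ _ → sps-id-isProp) λ _ →
        Π-isProp λ _ → Π-isProp λ _ → Π-isProp λ _ → sps-id-isProp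
        where
        sps-id-isProp : {X : Set ℓ} → isProp (sps {A = X} (λ x → x))
        sps-id-isProp = Π-isProp λ _ → λ { (_ , refl) (_ , refl) → refl }

    -- Spans of split fibred surjections and identifications of models.

    module _ {t : Level} {𝕋 : Theory t} where

      -- Once the homomorphism is the identity, what is left to compare are the proofs of modelhood
      -- and saturation and the splittings, and all of these inhabit propositions.
      FibSurj-contract : (𝓜 : SatMod 𝓗 𝕋) (w : Σ[ 𝓝 ∈ SatMod 𝓗 𝕋 ] FibSurj (str 𝓜) (str 𝓝)) →
                         (𝓜 , idF (str 𝓜)) ≡ w
      FibSurj-contract 𝓜 (𝓝 , m , surj) =
        subst
          (λ (S , h) → ∀ mod sat surj →
            _≡_ {A = Σ[ 𝓝 ∈ SatMod 𝓗 𝕋 ] FibSurj (str 𝓜) (str 𝓝)}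
              (𝓜 , idF (str 𝓜)) (record { str = S ; model = mod ; saturated = sat } , h , surj))
          (equivalences-contract (str 𝓜) (str 𝓝) m
            (mO-isEquiv m surj sM sN) (mA-isEquiv m surj sM sN) (mR-isEquiv m surj sM sN))
          at-identity (model 𝓝) sN surj
        where
        sM = saturated 𝓜
        sN = saturated 𝓝
        open Realisation 𝓗 (str 𝓜)
        at-identity : ∀ mod sat surj →
          _≡_ {A = Σ[ 𝓝 ∈ SatMod 𝓗 𝕋 ] FibSurj (str 𝓜) (str 𝓝)}
            (𝓜 , idF (str 𝓜))
            (record { str = str 𝓜 ; model = mod ; saturated = sat } , proj₁ (idF (str 𝓜)) , surj)
        at-identity mod sat surj =
          cong (λ (mod , sat , surj) →
                  record { str = str 𝓜 ; model = mod ; saturated = sat } , proj₁ (idF (str 𝓜)) , surj)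
            (×-isProp (IsModel-isProp 𝕋)
              (λ _ → ×-isProp TotallySaturated-isProp (λ _ → fibsurj-idF-isProp (str 𝓜)))
              (model 𝓜 , sM , proj₂ (idF (str 𝓜))) (mod , sat , surj))

      abstract
        FibSurj⇒≡ : (𝓜 𝓝 : SatMod 𝓗 𝕋) → FibSurj (str 𝓜) (str 𝓝) → 𝓜 ≡ 𝓝
        FibSurj⇒≡ 𝓜 𝓝 m = cong proj₁ (FibSurj-contract 𝓜 (𝓝 , m))

      FibSurj-induction :
        ∀ {c} (𝓜 : SatMod 𝓗 𝕋) (P : (𝓝 : SatMod 𝓗 𝕋) → FibSurj (str 𝓜) (str 𝓝) → Set c) →
        P 𝓜 (idF (str 𝓜)) → ∀ 𝓝 m → P 𝓝 m
      FibSurj-induction 𝓜 P p 𝓝 m = subst (λ (𝓝 , m) → P 𝓝 m) (FibSurj-contract 𝓜 (𝓝 , m)) p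

      -- On two identity legs this is `trans (sym p) p`, which cancels whatever the loop `p` is.
      -- Hence `FibSurj⇒≡` can stay abstract in both round trips.
      ≃ᶠ⇒≡ : (𝓜 𝓝 : SatMod 𝓗 𝕋) → 𝓜 ≃ᶠ 𝓝 → 𝓜 ≡ 𝓝
      ≃ᶠ⇒≡ 𝓜 𝓝 (𝓟 , m , n) = trans (sym (FibSurj⇒≡ 𝓟 𝓜 m)) (FibSurj⇒≡ 𝓟 𝓝 n)

      ≡⇒≃ᶠ : (𝓜 𝓝 : SatMod 𝓗 𝕋) → 𝓜 ≡ 𝓝 → 𝓜 ≃ᶠ 𝓝
      ≡⇒≃ᶠ 𝓜 .𝓜 refl = 𝓜 , idF (str 𝓜) , idF (str 𝓜)

      ≃ᶠ⇒≡-≡⇒≃ᶠ : (𝓜 𝓝 : SatMod 𝓗 𝕋) (e : 𝓜 ≡ 𝓝) → ≃ᶠ⇒≡ 𝓜 𝓝 (≡⇒≃ᶠ 𝓜 𝓝 e) ≡ e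
      ≃ᶠ⇒≡-≡⇒≃ᶠ 𝓜 .𝓜 refl = trans-symˡ (FibSurj⇒≡ 𝓜 𝓜 (idF (str 𝓜)))

      -- The left leg is contracted while `𝓝` and `n` stay fixed, then the right leg, which leaves
      -- the span of two identities.
      ≡⇒≃ᶠ-≃ᶠ⇒≡ : (𝓜 𝓝 : SatMod 𝓗 𝕋) (s : 𝓜 ≃ᶠ 𝓝) → ≡⇒≃ᶠ 𝓜 𝓝 (≃ᶠ⇒≡ 𝓜 𝓝 s) ≡ s
      ≡⇒≃ᶠ-≃ᶠ⇒≡ 𝓜 𝓝 (𝓟 , m , n) =
        FibSurj-induction 𝓟 (λ 𝓜 m → ≡⇒≃ᶠ 𝓜 𝓝 (≃ᶠ⇒≡ 𝓜 𝓝 (𝓟 , m , n)) ≡ (𝓟 , m , n))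
          (FibSurj-induction 𝓟
            (λ 𝓝 n → ≡⇒≃ᶠ 𝓟 𝓝 (≃ᶠ⇒≡ 𝓟 𝓝 (𝓟 , idF (str 𝓟) , n)) ≡ (𝓟 , idF (str 𝓟) , n))
            (cong (≡⇒≃ᶠ 𝓟 𝓟) (trans-symˡ (FibSurj⇒≡ 𝓟 𝓟 (idF (str 𝓟)))))
            𝓝 n)
          𝓜 m

theorem4p9 : ∀ {ℓ t : Level} (𝓗 : HoTT ℓ) (𝓛 : FOLDSSignature) →
    FOLDSSignature.height 𝓛 ≡ 3 →
    (𝕋 : FOLDS.Theory 𝓛 t) (𝓜 𝓝 : FOLDS.SatMod 𝓛 𝓗 𝕋) →
    (FOLDS._≃ᶠ_ 𝓛 𝓜 𝓝) ≃ (𝓜 ≡ 𝓝)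
theorem4p9 𝓗 𝓛 _ 𝕋 𝓜 𝓝 =
  ≃ᶠ⇒≡ 𝓛 𝓗 𝓜 𝓝 ,
  inverse⇒isEquiv (≡⇒≃ᶠ 𝓛 𝓗 𝓜 𝓝) (≡⇒≃ᶠ-≃ᶠ⇒≡ 𝓛 𝓗 𝓜 𝓝) (≃ᶠ⇒≡-≡⇒≃ᶠ 𝓛 𝓗 𝓜 𝓝)
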